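{- The supermarket model with MAPs and PH service times satisfies the Lipschitz condition: letting $F$ denote the right-hand side of its infinite-size system of differential vector equations $\frac{d}{dt}X(t)=F(X(t))$, there is a constant $M>0$ such that for all $y,z$ in the state space $\Omega$, $$|F(y)-F(z)|\le M\,\|y-z\|.$$
   Context: Notation: $e$ is a column vector of ones of suitable size; $\otimes$ is the Kronecker product; $a^{\odot d}$ is the entrywise $d$-th power of a vector $a$; $|\cdot|$ and $\|\cdot\|$ denote the $L_\infty$ (supremum) norm. Model. Customers arrive at $n>1$ servers by a Markovian arrival process (MAP) with irreducible matrix descriptor $(nC,nD)$ of size $m_A$ ($D\ge 0$ entrywise, $C$ has nonnegative off-diagonal entries, $(C+D)e=0$, $C+D$ irreducible), with stationary probability vector $\gamma$ of $C+D$ and $\lambda=\gamma De$. Service times are phase-type (PH) with irreducible representation $(\alpha,T)$ of order $m_B$: $\alpha$ is a probability row vector, $T$ has negative diagonal and nonnegative off-diagonal entries, $T^0=-Te\ge 0$, $T^0\neq 0$, $1/\mu=-\alpha T^{ -1}e$. Each arriving customer chooses $d\ge 1$ servers independently and uniformly at random and joins the one with fewest customers; $\rho=\lambda/\mu<1$. State space. $\Omega$ is the state space of the limiting ($n\to\infty$) process $X(t)$ of fractions of queues with at least $k$ customers: the set of sequences $g=(g^{(0)},g^{(1)},g^{(2)},\ldots)$ where $g^{(0)}$ is a probability row vector of size $m_A$, and $g^{(k)}$ ($k\ge1$) are row vectors of size $m_Am_B$ with entries in $[0,1]$ (they are fractions) satisfying $g^{(k-1)}\ge g^{(k)}\ge0$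 entrywise for $k\ge2$. The map $F=(F_0,F_1,F_2,\ldots)$ is $$F_0(g)=(g^{(0)})^{\odot d}C+g^{(1)}(I\otimes T^0),$$ $$F_1(g)=(g^{(0)})^{\odot d}(D\otimes\alpha)+(g^{(1)})^{\odot d}(C\otimes I)+g^{(1)}(I\otimes T)+g^{(2)}(I\otimes T^0\alpha),$$ $$F_k(g)=(g^{(k-1)})^{\odot d}(D\otimes I)+(g^{(k)})^{\odot d}(C\otimes I)+g^{(k)}(I\otimes T)+g^{(k+1)}(I\otimes T^0\alpha)\quad(k\ge2).$$ -}

module Defs where

open import Algebra.Bundles using (CommutativeRing)
open import Algebra.Core using (Op₁; Op₂)
open import Algebra.Structures using (IsCommutativeRing)
import Algebra.Construct.NaturalChoice.Max as Max
import Algebra.Properties.Semiring.Exp as Exp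
import Algebra.Properties.Semiring.Sum as Sum
open import Data.Fin.Base using (Fin; remQuot)
open import Data.Fin.Properties using (_≟_)
open import Data.Nat.Base as ℕ using (ℕ; zero; suc)
open import Data.Nat.Properties using (*-identityʳ)
open import Data.Product.Base using (Σ-syntax; ∃; ∃-syntax; _×_; _,_)
open import Data.Vec.Functional using (Vector)
open import Level using (0ℓ)
open import Relation.Binary.Bundles using (TotalOrder)
open import Relation.Binary.Construct.Closure.ReflexiveTransitive using (Star)
open import Relation.Binary.Core using (Rel)
import Relation.Binary.Construct.NonStrictToStrict as Strict
open import Relation.Binary.PropositionalEquality.Core using (_≢_; subst)
open import Relation.Binary.Structures using (IsTotalOrder)
open import Relation.Nullary.Decidable.Core using (yes; no)
open import Relation.Nullary.Negation.Core using (¬_)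
open import Relation.Unary using (Pred; Satisfiable)

module _ {A : Set} (_≤_ : Rel A 0ℓ) where

  UpperBound : Pred A 0ℓ → Pred A 0ℓ
  UpperBound P u = ∀ x → P x → x ≤ u

  IsLUB : Pred A 0ℓ → Pred A 0ℓ
  IsLUB P s = UpperBound P s × (∀ u → UpperBound P u → s ≤ u)

-- The classical real numbers, by their characterisation (unique up to
-- isomorphism) as a Dedekind-complete, totally ordered field.
record Reals : Set₁ where
  infix  4 _≈_ _≤_
  infixl 6 _+_
  infixl 7 _*_
  field
    Carrier           : Set
    _≈_               : Rel Carrier 0ℓ
    _≤_               : Rel Carrier 0ℓ
    _+_ _*_           : Op₂ Carrier
    -_                : Op₁ Carrier
    0# 1#             : Carrier
    isCommutativeRing : IsCommutativeRing _≈_ _+_ _*_ -_ 0# 1#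
    0≉1               : ¬ 0# ≈ 1#
    inverse           : ∀ x → ¬ x ≈ 0# → ∃[ y ] x * y ≈ 1#
    isTotalOrder      : IsTotalOrder _≈_ _≤_
    +-monoˡ-≤         : ∀ {x y} z → x ≤ y → x + z ≤ y + z
    *-nonNegative     : ∀ {x y} → 0# ≤ x → 0# ≤ y → 0# ≤ x * y
    complete          : ∀ (P : Pred Carrier 0ℓ) → Satisfiable P →
                        ∃ (UpperBound _≤_ P) → ∃ (IsLUB _≤_ P)

module RealMatrices (ℝ : Reals) where
  open Reals ℝ public using (_≤_)

  commutativeRing : CommutativeRing 0ℓ 0ℓ
  commutativeRing = record { isCommutativeRing = Reals.isCommutativeRing ℝ }

  totalOrder : TotalOrder 0ℓ 0ℓ 0ℓ
  totalOrder = record { isTotalOrder = Reals.isTotalOrder ℝ }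

  open CommutativeRing commutativeRing public
    using (Carrier; _≈_; _≉_; _+_; _*_; _-_; -_; 0#; 1#; semiring)
  open Max totalOrder public using (_⊔_)
  open Exp semiring public using (_^_)
  open Sum semiring public using (sum)
  open Strict _≈_ _≤_ public using (_<_)

  ∣_∣ : Carrier → Carrier
  ∣ x ∣ = x ⊔ (- x)

  Vec : ℕ → Set
  Vec = Vector Carrier

  Matrix : ℕ → ℕ → Set
  Matrix m n = Fin m → Fin n → Carrier

  private variable
    m n p q : ℕ

  infixl 6 _+ᵥ_ _+ₘ_
  infixl 7 _·_ _ᵥ*_ _*ᵥ_ _*ₘ_
  infixl 8 _⊗_
  infixr 9 _⊙^_

  _+ᵥ_ : Vec n → Vec n → Vec n
  (v +ᵥ w) i = v i + w i

  -ᵥ_ : Vec n → Vec n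
  (-ᵥ v) i = - v i

  _·_ : Vec n → Vec n → Carrier
  v · w = sum λ i → v i * w i

  _+ₘ_ : Matrix m n → Matrix m n → Matrix m n
  (A +ₘ B) i j = A i j + B i j

  _ᵥ*_ : Vec m → Matrix m n → Vec n
  (v ᵥ* A) j = sum λ i → v i * A i j

  _*ᵥ_ : Matrix m n → Vec n → Vec m
  (A *ᵥ v) i = sum λ j → A i j * v j

  _*ₘ_ : Matrix m n → Matrix n p → Matrix m p
  (A *ₘ B) i k = sum λ j → A i j * B j k

  e : Vec n
  e _ = 1#

  I : Matrix n n
  I i j with i ≟ j
  ... | yes _ = 1#
  ... | no  _ = 0#

  row : Vec n → Matrix 1 n
  row v _ j = v j

  column : Vec n → Matrix n 1
  column v i _ = v i

  _⊗_ : Matrix m n → Matrix p q → Matrix (m ℕ.* p) (n ℕ.* q)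
  _⊗_ {p = p} {q = q} A B i j =
    let (i₁ , i₂) = remQuot p i
        (j₁ , j₂) = remQuot q j
    in A i₁ j₁ * B i₂ j₂

  _⊗row_ : Matrix m n → Vec q → Matrix m (n ℕ.* q)
  _⊗row_ {m} {n} {q} A v =
    subst (λ k → Matrix k (n ℕ.* q)) (*-identityʳ m) (A ⊗ row v)

  _⊗column_ : Matrix m n → Vec p → Matrix (m ℕ.* p) n
  _⊗column_ {m} {n} {p} A v =
    subst (Matrix (m ℕ.* p)) (*-identityʳ n) (A ⊗ column v)

  _⊙^_ : Vec n → ℕ → Vec n
  (v ⊙^ d) i = v i ^ d

  IsProbability : Vec n → Set
  IsProbability v = (∀ i → 0# ≤ v i) × v · e ≈ 1#

  -- Strong connectedness of the directed graph of nonzero entries.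
  Irreducible : Matrix n n → Set
  Irreducible A = ∀ i j → Star (λ k l → A k l ≉ 0#) i j

record SupermarketModel (ℝ : Reals) : Set where
  open RealMatrices ℝ
  field
    -- n scales the arrival descriptor to (n C , n D); it does not enter the
    -- limiting dynamics.
    n   : ℕ
    n>1 : n ℕ.> 1
    d   : ℕ
    d≥1 : d ℕ.≥ 1

    m-A           : ℕ
    C D           : Matrix m-A m-A
    D-nonNegative : ∀ i j → 0# ≤ D i j
    C-offDiagonal : ∀ i j → i ≢ j → 0# ≤ C i j
    C+D-rowSums   : ∀ i → ((C +ₘ D) *ᵥ e) i ≈ 0#
    C+D-irred     : Irreducible (C +ₘ D)
    γ             : Vec m-A
    γ-probability : IsProbability γ
    γ-stationary  : ∀ j → (γ ᵥ* (C +ₘ D)) j ≈ 0#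

    m-B           : ℕ
    α             : Vec m-B
    α-probability : IsProbability α
    T             : Matrix m-B m-B
    T-diagonal    : ∀ i → T i i < 0#
    T-offDiagonal : ∀ i j → i ≢ j → 0# ≤ T i j

  T⁰ : Vec m-B
  T⁰ = -ᵥ (T *ᵥ e)

  T⁰α : Matrix m-B m-B
  T⁰α = column T⁰ *ₘ row α

  field
    T⁰-nonNegative : ∀ i → 0# ≤ T⁰ i
    T⁰-nonZero     : ¬ (∀ i → T⁰ i ≈ 0#)
    -- Irreducibility of the phase process of the associated renewal process,
    -- the usual meaning of an irreducible phase-type representation.
    PH-irred       : Irreducible (T +ₘ T⁰α)
    T⁻¹            : Matrix m-B m-B
    T⁻¹-inverseˡ   : ∀ i j → (T⁻¹ *ₘ T) i j ≈ I i j
    T⁻¹-inverseʳ   : ∀ i j → (T *ₘ T⁻¹) i j ≈ I i j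

  arrivalRate : Carrier
  arrivalRate = γ · (D *ᵥ e)

  meanService : Carrier
  meanService = - (α · (T⁻¹ *ᵥ e))

  field
    μ              : Carrier
    μ*meanService  : μ * meanService ≈ 1#
    ρ              : Carrier
    ρ*μ            : ρ * μ ≈ arrivalRate
    ρ<1            : ρ < 1#

module Dynamics {ℝ : Reals} (S : SupermarketModel ℝ) where
  open RealMatrices ℝ public
  open SupermarketModel S

  size : ℕ → ℕ
  size zero    = m-A
  size (suc _) = m-A ℕ.* m-B

  Sequence : Set
  Sequence = ∀ k → Vec (size k)

  _⊖_ : Sequence → Sequence → Sequence
  (x ⊖ y) k i = x k i - y k i

  record Ω (g : Sequence) : Set where
    field
      probability : IsProbability (g 0)
      nonNegative : ∀ k i → 0# ≤ g (suc k) i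
      atMostOne   : ∀ k i → g (suc k) i ≤ 1#
      decreasing  : ∀ k i → g (suc (suc k)) i ≤ g (suc k) i

  F : Sequence → Sequence
  F g 0 = (g 0 ⊙^ d) ᵥ* C
       +ᵥ g 1 ᵥ* (I {m-A} ⊗column T⁰)
  F g 1 = (g 0 ⊙^ d) ᵥ* (D ⊗row α)
       +ᵥ (g 1 ⊙^ d) ᵥ* (C ⊗ I {m-B})
       +ᵥ g 1 ᵥ* (I {m-A} ⊗ T)
       +ᵥ g 2 ᵥ* (I {m-A} ⊗ T⁰α)
  F g (suc k@(suc _)) =
          (g k ⊙^ d) ᵥ* (D ⊗ I {m-B})
       +ᵥ (g (suc k) ⊙^ d) ᵥ* (C ⊗ I {m-B})
       +ᵥ g (suc k) ᵥ* (I {m-A} ⊗ T)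
       +ᵥ g (suc (suc k)) ᵥ* (I {m-A} ⊗ T⁰α)

  -- The supremum norm of a sequence is a real number only if the sequence is
  -- bounded, hence a relation.
  IsNorm : Sequence → Carrier → Set
  IsNorm x = IsLUB _≤_ λ r → Σ[ k ∈ ℕ ] Σ[ i ∈ Fin (size k) ] r ≈ ∣ x k i ∣

{-# OPTIONS --safe #-}

-- On [0,1] the power x ↦ x ^ d is Lipschitz with constant d, and
-- v ↦ v ᵥ* A is Lipschitz with constant the entrywise 1-norm of A. Every
-- component of F is a sum of such maps, and only three shapes of components
-- occur (k = 0, k = 1, k ≥ 2), so the largest of three constants serves them
-- all. Entries of Ω lie in [0,1], so the suprema exist by completeness.
module Submission where

open import Defs
open import Algebra.Bundles using (CommutativeRing)
import Algebra.Construct.NaturalChoice.Max as Max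
import Algebra.Properties.AbelianGroup as AbelianGroupProperties
import Algebra.Properties.CommutativeSemigroup as CommutativeSemigroupProperties
import Algebra.Properties.Ring as RingProperties
import Algebra.Properties.Semiring.Mult as Mult
import Algebra.Properties.Semiring.Sum as SumProperties
open import Data.Empty using (⊥-elim)
open import Data.Fin.Base using (Fin; zero; suc)
open import Data.Nat.Base using (ℕ; zero; suc)
open import Data.Product.Base using (∃; ∃-syntax; _×_; _,_; proj₁; proj₂)
open import Data.Sum.Base using (inj₁; inj₂)
open import Relation.Binary.Bundles using (TotalOrder)
import Relation.Binary.Reasoning.PartialOrder as PartialOrderReasoning

module RealProperties (ℝ : Reals) where

  open RealMatrices ℝ
  open CommutativeRing commutativeRing
    using (sym; ring; +-cong; +-congˡ; +-congʳ; +-identityˡ; +-identityʳ;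
           +-assoc; +-comm; -‿cong; -‿inverseʳ; *-congˡ; *-comm; *-identityˡ;
           *-identityʳ; *-assoc; distribˡ; zeroʳ;
           +-abelianGroup; +-commutativeSemigroup)
  open TotalOrder totalOrder
    using (total; poset; ≤-respˡ-≈; ≤-respʳ-≈; antisym)
    renaming (refl to ≤-refl; trans to ≤-trans)
  open Max totalOrder using (x≤x⊔y; x≤y⊔x; ⊔-lub; ⊔-cong)
  open AbelianGroupProperties +-abelianGroup
    using () renaming (⁻¹-involutive to -‿involutive; ⁻¹-∙-comm to -‿+-comm;
                       //-rightDividesˡ to x-y+y≈x)
  open CommutativeSemigroupProperties +-commutativeSemigroup
    using (interchange)
  open RingProperties ring
    using (-‿distribˡ-*; -‿distribʳ-*; [y-z]x≈yx-zx; x[y-z]≈xy-xz)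
  open SumProperties semiring using (*-distribˡ-sum)
  open Mult semiring public using () renaming (_×_ to _×′_)
  open PartialOrderReasoning poset

  private variable
    n m : ℕ
    w x y z : Carrier

  -- Order and arithmetic in the reals.

  +-mono-≤ : w ≤ x → y ≤ z → w + y ≤ x + z
  +-mono-≤ {w} {x} {y} {z} w≤x y≤z = begin
    w + y ≤⟨ Reals.+-monoˡ-≤ ℝ y w≤x ⟩
    x + y ≈⟨ +-comm x y ⟩
    y + x ≤⟨ Reals.+-monoˡ-≤ ℝ x y≤z ⟩
    z + x ≈⟨ +-comm z x ⟩
    x + z ∎

  x≤y⇒0≤y-x : x ≤ y → 0# ≤ y - x
  x≤y⇒0≤y-x {x} x≤y = ≤-respˡ-≈ (-‿inverseʳ x) (Reals.+-monoˡ-≤ ℝ (- x) x≤y)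

  0≤y-x⇒x≤y : 0# ≤ y - x → x ≤ y
  0≤y-x⇒x≤y {y} {x} 0≤y-x = begin
    x           ≈⟨ +-identityˡ x ⟨
    0# + x      ≤⟨ Reals.+-monoˡ-≤ ℝ x 0≤y-x ⟩
    y - x + x   ≈⟨ x-y+y≈x x y ⟩
    y           ∎

  x≤0⇒0≤-x : x ≤ 0# → 0# ≤ - x
  x≤0⇒0≤-x {x} x≤0 = ≤-respʳ-≈ (+-identityˡ (- x)) (x≤y⇒0≤y-x x≤0)

  0≤x⇒-x≤0 : 0# ≤ x → - x ≤ 0#
  0≤x⇒-x≤0 {x} 0≤x = 0≤y-x⇒x≤y (begin
    0#          ≤⟨ 0≤x ⟩
    x           ≈⟨ -‿involutive x ⟨
    - - x       ≈⟨ +-identityˡ (- - x) ⟨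
    0# - - x    ∎)

  -- The axioms speak only of products of nonnegative numbers, so the inequality is turned into
  -- nonnegativity of `(y - x) * z`.
  *-monoʳ-≤ : 0# ≤ z → x ≤ y → x * z ≤ y * z
  *-monoʳ-≤ {z} {x} {y} 0≤z x≤y = 0≤y-x⇒x≤y
    (≤-respʳ-≈ ([y-z]x≈yx-zx z y x) (Reals.*-nonNegative ℝ (x≤y⇒0≤y-x x≤y) 0≤z))

  *-monoˡ-≤ : 0# ≤ z → x ≤ y → z * x ≤ z * y
  *-monoˡ-≤ {z} {x} {y} 0≤z x≤y = 0≤y-x⇒x≤y
    (≤-respʳ-≈ (x[y-z]≈xy-xz z y x) (Reals.*-nonNegative ℝ 0≤z (x≤y⇒0≤y-x x≤y)))

  -x*-y≈x*y : ∀ x y → - x * - y ≈ x * y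
  -x*-y≈x*y x y = begin-equality
    - x * - y    ≈⟨ -‿distribˡ-* x (- y) ⟨
    - (x * - y)  ≈⟨ -‿cong (-‿distribʳ-* x y) ⟨
    - - (x * y)  ≈⟨ -‿involutive (x * y) ⟩
    x * y        ∎

  0≤1 : 0# ≤ 1#
  0≤1 with total 0# 1#
  ... | inj₁ 0≤1 = 0≤1
  -- Here `- 1#` would be nonnegative, hence so would its square, which is `1#`.
  ... | inj₂ 1≤0 = begin
    0#          ≤⟨ Reals.*-nonNegative ℝ 0≤-1 0≤-1 ⟩
    - 1# * - 1# ≈⟨ -x*-y≈x*y 1# 1# ⟩
    1# * 1#     ≈⟨ *-identityˡ 1# ⟩
    1#          ∎
    where 0≤-1 = x≤0⇒0≤-x 1≤0

  1≤x⇒0<x : 1# ≤ x → 0# < x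
  1≤x⇒0<x 1≤x = ≤-trans 0≤1 1≤x ,
    λ 0≈x → Reals.0≉1 ℝ (antisym 0≤1 (≤-respʳ-≈ (sym 0≈x) 1≤x))

  -- Absolute value.

  ∣∣-cong : x ≈ y → ∣ x ∣ ≈ ∣ y ∣
  ∣∣-cong x≈y = ⊔-cong x≈y (-‿cong x≈y)

  x≤∣x∣ : ∀ x → x ≤ ∣ x ∣
  x≤∣x∣ x = x≤x⊔y x (- x)

  -x≤∣x∣ : ∀ x → - x ≤ ∣ x ∣
  -x≤∣x∣ x = x≤y⊔x x (- x)

  ∣-x∣≤∣x∣ : ∀ x → ∣ - x ∣ ≤ ∣ x ∣
  ∣-x∣≤∣x∣ x = ⊔-lub (-x≤∣x∣ x) (≤-respˡ-≈ (sym (-‿involutive x)) (x≤∣x∣ x))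

  0≤∣x∣ : ∀ x → 0# ≤ ∣ x ∣
  0≤∣x∣ x with total 0# x
  ... | inj₁ 0≤x = ≤-trans 0≤x (x≤∣x∣ x)
  ... | inj₂ x≤0 = ≤-trans (x≤0⇒0≤-x x≤0) (-x≤∣x∣ x)

  0≤x⇒∣x∣≤x : 0# ≤ x → ∣ x ∣ ≤ x
  0≤x⇒∣x∣≤x 0≤x = ⊔-lub ≤-refl (≤-trans (0≤x⇒-x≤0 0≤x) 0≤x)

  ∣x+y∣≤∣x∣+∣y∣ : ∀ x y → ∣ x + y ∣ ≤ ∣ x ∣ + ∣ y ∣
  ∣x+y∣≤∣x∣+∣y∣ x y = ⊔-lub (+-mono-≤ (x≤∣x∣ x) (x≤∣x∣ y))
    (≤-respˡ-≈ (-‿+-comm x y) (+-mono-≤ (-x≤∣x∣ x) (-x≤∣x∣ y)))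

  -- Monotonicity needs nonnegative factors. If `y` is negative, both signs are flipped first, which
  -- leaves the product unchanged.
  x*y≤∣x∣*∣y∣ : ∀ x y → x * y ≤ ∣ x ∣ * ∣ y ∣
  x*y≤∣x∣*∣y∣ x y with total 0# y
  ... | inj₁ 0≤y = begin
    x * y          ≤⟨ *-monoʳ-≤ 0≤y (x≤∣x∣ x) ⟩
    ∣ x ∣ * y      ≤⟨ *-monoˡ-≤ (0≤∣x∣ x) (x≤∣x∣ y) ⟩
    ∣ x ∣ * ∣ y ∣  ∎
  ... | inj₂ y≤0 = begin
    x * y          ≈⟨ -x*-y≈x*y x y ⟨
    - x * - y      ≤⟨ *-monoʳ-≤ (x≤0⇒0≤-x y≤0) (-x≤∣x∣ x) ⟩
    ∣ x ∣ * - y    ≤⟨ *-monoˡ-≤ (0≤∣x∣ x) (-x≤∣x∣ y) ⟩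
    ∣ x ∣ * ∣ y ∣  ∎

  ∣x*y∣≤∣x∣*∣y∣ : ∀ x y → ∣ x * y ∣ ≤ ∣ x ∣ * ∣ y ∣
  ∣x*y∣≤∣x∣*∣y∣ x y = ⊔-lub (x*y≤∣x∣*∣y∣ x y) (begin
    - (x * y)        ≈⟨ -‿distribˡ-* x y ⟩
    - x * y          ≤⟨ x*y≤∣x∣*∣y∣ (- x) y ⟩
    ∣ - x ∣ * ∣ y ∣  ≤⟨ *-monoʳ-≤ (0≤∣x∣ y) (∣-x∣≤∣x∣ x) ⟩
    ∣ x ∣ * ∣ y ∣    ∎)

  -- Finite sums of nonnegative terms.

  sum-nonNegative : {v : Vec n} → (∀ i → 0# ≤ v i) → 0# ≤ sum v
  sum-nonNegative {zero}  0≤v = ≤-refl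
  sum-nonNegative {suc n} 0≤v = ≤-respˡ-≈ (+-identityˡ 0#)
    (+-mono-≤ (0≤v zero) (sum-nonNegative λ i → 0≤v (suc i)))

  entry≤sum : {v : Vec n} → (∀ i → 0# ≤ v i) → ∀ i → v i ≤ sum v
  entry≤sum {v = v} 0≤v zero = ≤-respˡ-≈ (+-identityʳ (v zero))
    (+-mono-≤ ≤-refl (sum-nonNegative λ i → 0≤v (suc i)))
  entry≤sum {v = v} 0≤v (suc i) = ≤-respˡ-≈ (+-identityˡ (v (suc i)))
    (+-mono-≤ (0≤v zero) (entry≤sum (λ i → 0≤v (suc i)) i))

  -- The unit interval and probability vectors.

  InUnitInterval : Carrier → Set
  InUnitInterval x = 0# ≤ x × x ≤ 1#

  ^-inUnitInterval : InUnitInterval x → ∀ d → InUnitInterval (x ^ d)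
  ^-inUnitInterval         x∈ zero    = 0≤1 , ≤-refl
  ^-inUnitInterval {x = x} x∈@(0≤x , x≤1) (suc d) =
    let (0≤xᵈ , xᵈ≤1) = ^-inUnitInterval x∈ d in
    Reals.*-nonNegative ℝ 0≤x 0≤xᵈ , (begin
      x * x ^ d   ≤⟨ *-monoʳ-≤ 0≤xᵈ x≤1 ⟩
      1# * x ^ d  ≈⟨ *-identityˡ (x ^ d) ⟩
      x ^ d       ≤⟨ xᵈ≤1 ⟩
      1#          ∎)

  inUnitInterval⇒∣x-y∣≤1 : InUnitInterval x → InUnitInterval y → ∣ x - y ∣ ≤ 1#
  inUnitInterval⇒∣x-y∣≤1 {x} {y} (0≤x , x≤1) (0≤y , y≤1) = ⊔-lub
    (≤-respʳ-≈ (+-identityʳ 1#) (+-mono-≤ x≤1 (0≤x⇒-x≤0 0≤y)))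
    (begin
      - (x - y)   ≈⟨ -‿+-comm x (- y) ⟨
      - x - - y   ≈⟨ +-congˡ (-‿involutive y) ⟩
      - x + y     ≤⟨ +-mono-≤ (0≤x⇒-x≤0 0≤x) y≤1 ⟩
      0# + 1#     ≈⟨ +-identityˡ 1# ⟩
      1#          ∎)

  -- An empty vector sums to 0, not 1. The index later shows that the set of absolute entries is
  -- inhabited, as completeness demands.
  IsProbability⇒index : {v : Vec n} → IsProbability v → Fin n
  IsProbability⇒index {zero}  (_ , 0≈1) = ⊥-elim (Reals.0≉1 ℝ 0≈1)
  IsProbability⇒index {suc n} _         = zero

  IsProbability⇒inUnitInterval : {v : Vec n} → IsProbability v →
                                 ∀ i → InUnitInterval (v i)
  IsProbability⇒inUnitInterval {v = v} (0≤v , v·e≈1) i = 0≤v i , (begin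
    v i       ≈⟨ *-identityʳ (v i) ⟨
    v i * 1#  ≤⟨ entry≤sum (λ i → ≤-respʳ-≈ (sym (*-identityʳ (v i))) (0≤v i)) i ⟩
    v · e     ≈⟨ v·e≈1 ⟩
    1#        ∎)

  -- Matrix norm and Lipschitz estimates.

  rowNorm : Matrix m n → Fin m → Carrier
  rowNorm A i = sum λ j → ∣ A i j ∣

  ∥_∥ : Matrix m n → Carrier
  ∥ A ∥ = sum (rowNorm A)

  -- Closeness measured in multiples of b, the distance of the arguments.
  module Closeness (b : Carrier) where

    -- With `L` as a parameter, the rules below build the Lipschitz constant along with the
    -- estimate.
    Close : Carrier → Carrier → Carrier → Set
    Close L x y = ∣ x - y ∣ ≤ b * L

    ≤⇒Close : ∣ x - y ∣ ≤ b → Close 1# x y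
    ≤⇒Close = ≤-respʳ-≈ (sym (*-identityʳ b))

    Close-refl : ∀ x → Close 0# x x
    Close-refl x = begin
      ∣ x - x ∣  ≈⟨ ∣∣-cong (-‿inverseʳ x) ⟩
      ∣ 0# ∣     ≤⟨ 0≤x⇒∣x∣≤x ≤-refl ⟩
      0#         ≈⟨ zeroʳ b ⟨
      b * 0#     ∎

    private variable
      K L : Carrier

    Close-trans : Close K x y → Close L y z → Close (K + L) x z
    Close-trans {K} {x} {y} {L} {z} p q = begin
      ∣ x - z ∣                ≈⟨ ∣∣-cong (+-congʳ (x-y+y≈x y x)) ⟨
      ∣ x - y + y - z ∣        ≈⟨ ∣∣-cong (+-assoc (x - y) y (- z)) ⟩
      ∣ x - y + (y - z) ∣      ≤⟨ ∣x+y∣≤∣x∣+∣y∣ (x - y) (y - z) ⟩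
      ∣ x - y ∣ + ∣ y - z ∣    ≤⟨ +-mono-≤ p q ⟩
      b * K + b * L            ≈⟨ distribˡ b K L ⟨
      b * (K + L)              ∎

    Close-+ : Close K w x → Close L y z → Close (K + L) (w + y) (x + z)
    Close-+ {K} {w} {x} {L} {y} {z} p q = begin
      ∣ (w + y) - (x + z) ∣        ≈⟨ ∣∣-cong (+-congˡ (-‿+-comm x z)) ⟨
      ∣ (w + y) + (- x - z) ∣      ≈⟨ ∣∣-cong (interchange w y (- x) (- z)) ⟩
      ∣ (w - x) + (y - z) ∣        ≤⟨ ∣x+y∣≤∣x∣+∣y∣ (w - x) (y - z) ⟩
      ∣ w - x ∣ + ∣ y - z ∣        ≤⟨ +-mono-≤ p q ⟩
      b * K + b * L                ≈⟨ distribˡ b K L ⟨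
      b * (K + L)                  ∎

    Close-*ʳ : ∣ z ∣ ≤ K → Close L x y → Close (L * K) (x * z) (y * z)
    Close-*ʳ {z} {K} {L} {x} {y} ∣z∣≤K p = begin
      ∣ x * z - y * z ∣  ≈⟨ ∣∣-cong ([y-z]x≈yx-zx z x y) ⟨
      ∣ (x - y) * z ∣    ≤⟨ ∣x*y∣≤∣x∣*∣y∣ (x - y) z ⟩
      ∣ x - y ∣ * ∣ z ∣  ≤⟨ *-monoˡ-≤ (0≤∣x∣ (x - y)) ∣z∣≤K ⟩
      -- `K` is nonnegative because it dominates `∣ z ∣`.
      ∣ x - y ∣ * K      ≤⟨ *-monoʳ-≤ (≤-trans (0≤∣x∣ z) ∣z∣≤K) p ⟩
      b * L * K          ≈⟨ *-assoc b L K ⟩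
      b * (L * K)        ∎

    Close-resp-≈ : K ≈ L → Close K x y → Close L x y
    Close-resp-≈ K≈L = ≤-respʳ-≈ (*-congˡ K≈L)

    Close-*ʳ-unit : InUnitInterval z → Close L x y → Close L (x * z) (y * z)
    Close-*ʳ-unit {L = L} (0≤z , z≤1) p = Close-resp-≈ (*-identityʳ L)
      (Close-*ʳ (≤-trans (0≤x⇒∣x∣≤x 0≤z) z≤1) p)

    Close-*ˡ-unit : InUnitInterval z → Close L x y → Close L (z * x) (z * y)
    Close-*ˡ-unit {z} {L} {x} {y} z∈ p =
      ≤-respˡ-≈ (∣∣-cong (+-cong (*-comm x z) (-‿cong (*-comm y z))))
        (Close-*ʳ-unit z∈ p)

    -- Pass from `x * x ^ d` to `y * x ^ d` to `y * y ^ d`. The unchanged factor lies in the unit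
    -- interval and costs nothing, so each exponent step adds 1 to the constant.
    Close-^ : InUnitInterval x → InUnitInterval y → Close 1# x y →
              ∀ d → Close (d ×′ 1#) (x ^ d) (y ^ d)
    Close-^ x∈ y∈ p zero    = Close-refl 1#
    Close-^ x∈ y∈ p (suc d) =
      Close-trans (Close-*ʳ-unit (^-inUnitInterval x∈ d) p)
                  (Close-*ˡ-unit y∈ (Close-^ x∈ y∈ p d))

    Close-sum : {Ls v w : Vec n} → (∀ i → Close (Ls i) (v i) (w i)) →
                Close (sum Ls) (sum v) (sum w)
    Close-sum {zero}  p = Close-refl 0#
    Close-sum {suc n} p = Close-+ (p zero) (Close-sum λ i → p (suc i))

    -- An entry of row `i` is at most the sum of absolute values of that row, so term `i` has
    -- constant `L * rowNorm A i` whatever the column `j`. Then `L` is factored out of the sum.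
    Close-ᵥ* : (A : Matrix m n) {v w : Vec m} → (∀ i → Close L (v i) (w i)) →
               ∀ j → Close (L * ∥ A ∥) ((v ᵥ* A) j) ((w ᵥ* A) j)
    Close-ᵥ* {L = L} A p j =
      Close-resp-≈ (sym (*-distribˡ-sum L (rowNorm A)))
        (Close-sum λ i → Close-*ʳ (entry≤sum (λ j → 0≤∣x∣ (A i j)) j) (p i))

module _ {ℝ : Reals} (S : SupermarketModel ℝ) where

  open Dynamics S
  open SupermarketModel S
  open RealProperties ℝ
  open CommutativeRing commutativeRing using (refl; sym; *-comm)
  open TotalOrder totalOrder
    using (poset; ≤-respˡ-≈) renaming (trans to ≤-trans)
  open Max totalOrder using (x≤x⊔y; x≤y⊔x)

  -- Bounds on the state space and suprema of sequences.

  Ω⇒inUnitInterval : ∀ {g} → Ω g → ∀ k i → InUnitInterval (g k i)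
  Ω⇒inUnitInterval g∈ zero    = IsProbability⇒inUnitInterval (Ω.probability g∈)
  Ω⇒inUnitInterval g∈ (suc k) i = Ω.nonNegative g∈ k i , Ω.atMostOne g∈ k i

  -- Completeness needs a point and an upper bound: `i` gives an entry at level 0, `u` the bound.
  norm-exists : ∀ x u → Fin m-A → (∀ k i → ∣ x k i ∣ ≤ u) → ∃ (IsNorm x)
  norm-exists x u i bound = Reals.complete ℝ _
    (∣ x 0 i ∣ , 0 , i , refl)
    (u , λ { r (k , j , r≈) → ≤-respˡ-≈ (sym r≈) (bound k j) })

  entry≤norm : ∀ x {b} → IsNorm x b → ∀ k i → ∣ x k i ∣ ≤ b
  entry≤norm x (upper , _) k i = upper ∣ x k i ∣ (k , i , refl)

  norm≤ : ∀ x {a u} → IsNorm x a → (∀ k i → ∣ x k i ∣ ≤ u) → a ≤ u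
  norm≤ x {u = u} (_ , least) bound =
    least u λ { r (k , i , r≈) → ≤-respˡ-≈ (sym r≈) (bound k i) }

  -- Lipschitz constants of the components of `F`.

  lipschitzConstant : ℕ → Carrier
  lipschitzConstant 0 =
      (d ×′ 1#) * ∥ C ∥
    + 1# * ∥ I {m-A} ⊗column T⁰ ∥
  lipschitzConstant 1 =
      (d ×′ 1#) * ∥ D ⊗row α ∥
    + (d ×′ 1#) * ∥ C ⊗ I {m-B} ∥
    + 1# * ∥ I {m-A} ⊗ T ∥
    + 1# * ∥ I {m-A} ⊗ T⁰α ∥
  -- The value does not depend on the level, so infinitely many components share one constant.
  lipschitzConstant (suc (suc _)) =
      (d ×′ 1#) * ∥ D ⊗ I {m-B} ∥
    + (d ×′ 1#) * ∥ C ⊗ I {m-B} ∥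
    + 1# * ∥ I {m-A} ⊗ T ∥
    + 1# * ∥ I {m-A} ⊗ T⁰α ∥

  module _ (b : Carrier) {y z : Sequence} (y∈Ω : Ω y) (z∈Ω : Ω z)
           (near : ∀ k i → ∣ y k i - z k i ∣ ≤ b) where

    open Closeness b

    private
      linear : ∀ k {n} (A : Matrix (size k) n) j →
               Close (1# * ∥ A ∥) ((y k ᵥ* A) j) ((z k ᵥ* A) j)
      linear k A = Close-ᵥ* A λ i → ≤⇒Close (near k i)

      power : ∀ k {n} (A : Matrix (size k) n) j →
              Close ((d ×′ 1#) * ∥ A ∥)
                    (((y k ⊙^ d) ᵥ* A) j) (((z k ⊙^ d) ᵥ* A) j)
      power k A = Close-ᵥ* A λ i →
        Close-^ (Ω⇒inUnitInterval y∈Ω k i) (Ω⇒inUnitInterval z∈Ω k i)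
                (≤⇒Close (near k i)) d

    -- The nesting of `Close-+` copies that of the sums in `F`: `power` serves the terms with `d`-th
    -- powers, `linear` the others.
    F-close : ∀ k j → Close (lipschitzConstant k) (F y k j) (F z k j)
    F-close 0 j =
      Close-+ (power 0 C j)
              (linear 1 (I {m-A} ⊗column T⁰) j)
    F-close 1 j =
      Close-+ (Close-+ (Close-+ (power 0 (D ⊗row α) j)
                                (power 1 (C ⊗ I {m-B}) j))
                       (linear 1 (I {m-A} ⊗ T) j))
              (linear 2 (I {m-A} ⊗ T⁰α) j)
    F-close (suc k@(suc _)) j =
      Close-+ (Close-+ (Close-+ (power k (D ⊗ I {m-B}) j)
                                (power (suc k) (C ⊗ I {m-B}) j))
                       (linear (suc k) (I {m-A} ⊗ T) j))
              (linear (suc (suc k)) (I {m-A} ⊗ T⁰α) j)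

  -- One constant for all components.

  largestConstant : Carrier
  largestConstant =
    -- The leading `1#` makes the constant strictly positive.
    1# ⊔ lipschitzConstant 0 ⊔ lipschitzConstant 1 ⊔ lipschitzConstant 2

  1≤largestConstant : 1# ≤ largestConstant
  1≤largestConstant =
    ≤-trans (≤-trans (x≤x⊔y _ _) (x≤x⊔y _ _)) (x≤x⊔y _ _)

  lipschitzConstant≤largest : ∀ k → lipschitzConstant k ≤ largestConstant
  lipschitzConstant≤largest 0 =
    ≤-trans (≤-trans (x≤y⊔x _ _) (x≤x⊔y _ _)) (x≤x⊔y _ _)
  lipschitzConstant≤largest 1             = ≤-trans (x≤y⊔x _ _) (x≤x⊔y _ _)
  lipschitzConstant≤largest (suc (suc _)) = x≤y⊔x _ _

  F-lipschitz : ∀ {y z} → Ω y → Ω z →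
    ∃[ a ] ∃[ b ] (IsNorm (F y ⊖ F z) a × IsNorm (y ⊖ z) b × a ≤ largestConstant * b)
  F-lipschitz {y} {z} y∈Ω z∈Ω = a , b , a-norm , b-norm , norm≤ (F y ⊖ F z) a-norm bound
    where
    open PartialOrderReasoning poset

    index : Fin m-A
    index = IsProbability⇒index (Ω.probability y∈Ω)

    distance : ∃ (IsNorm (y ⊖ z))
    -- Two numbers in the unit interval differ by at most 1, so 1 bounds all entries of `y ⊖ z`.
    distance = norm-exists (y ⊖ z) 1# index λ k i →
      inUnitInterval⇒∣x-y∣≤1 (Ω⇒inUnitInterval y∈Ω k i) (Ω⇒inUnitInterval z∈Ω k i)

    b = proj₁ distance
    b-norm = proj₂ distance

    near : ∀ k i → ∣ y k i - z k i ∣ ≤ b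
    near = entry≤norm (y ⊖ z) b-norm

    bound : ∀ k i → ∣ F y k i - F z k i ∣ ≤ largestConstant * b
    bound k i = begin
      ∣ F y k i - F z k i ∣    ≤⟨ F-close b y∈Ω z∈Ω near k i ⟩
      -- Enlarging the constant needs `b` nonnegative: it dominates the absolute value at `index`.
      b * lipschitzConstant k  ≤⟨ *-monoˡ-≤ (≤-trans (0≤∣x∣ _) (near 0 index))
                                            (lipschitzConstant≤largest k) ⟩
      b * largestConstant      ≈⟨ *-comm b largestConstant ⟩
      largestConstant * b      ∎

    imageDistance : ∃ (IsNorm (F y ⊖ F z))
    -- The Lipschitz bound on entries is also what makes this supremum exist.
    imageDistance = norm-exists (F y ⊖ F z) (largestConstant * b) index bound

    a = proj₁ imageDistance
    a-norm = proj₂ imageDistance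

theorem5 : (ℝ : Reals) (S : SupermarketModel ℝ) →
    let open Dynamics S in
    ∃[ M ] (0# < M ×
    (∀ (y z : Sequence) → Ω y → Ω z →
    ∃[ a ] ∃[ b ] (IsNorm (F y ⊖ F z) a × IsNorm (y ⊖ z) b × a ≤ M * b)))
theorem5 ℝ S =
  largestConstant S , 1≤x⇒0<x (1≤largestConstant S) , λ y z → F-lipschitz S
  where open RealProperties ℝ
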